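{- Let $n\ge 1$ and $0\le k\le n-1$ be integers. Then $$\begin{bmatrix} n\\ k\end{bmatrix}_{\mathcal{F}}=\sum_{i=0}^{k}\left\{ q^{F_{n-k}\sum_{j=1}^{i}F_{k-j+2}}\left(\prod_{j=1}^{i}[F_{n-k-1}]_{q^{F_{k-j+1}}}\right)[F_{k-i+1}]_{q^{F_{n-k}}}\begin{bmatrix} n-i-1\\ k-i\end{bmatrix}_{\mathcal{F}}\right\}.$$
   Context: Fibonacci numbers: $F_0=0$, $F_1=1$, $F_n=F_{n-1}+F_{n-2}$. For an integer $m\ge 0$, $[m]_q=\sum_{i=0}^{m-1}q^i$ (so $[0]_q=0$), with $q$ an indeterminate, and $[m]_{q^s}=\sum_{i=0}^{m-1}q^{si}$ for an integer $s\ge 0$. Put $[F_m]_q!=\prod_{i=1}^m [F_i]_q$ (with $[F_0]_q!=1$). The $q$-Fibonomial coefficient is, for integers $0\le k\le n$, $$\begin{bmatrix} n\\ k\end{bmatrix}_{\mathcal{F}}=\frac{[F_n]_q!}{[F_k]_q!\,[F_{n-k}]_q!}.$$ Empty sums are $0$ and empty products are $1$. -}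

module Defs where

open import Algebra.Bundles.Raw using (RawMonoid; RawSemiring)
open import Data.Empty using (⊥-elim)
open import Data.Fin.Base as Fin using (Fin; toℕ)
open import Data.Integer.Base as ℤ using (ℤ; 0ℤ; 1ℤ)
import Data.Integer.Properties as ℤ
open import Data.List.Base using (List; []; _∷_; map)
open import Data.Nat.Base as ℕ using (ℕ; zero; suc; _∸_; _<_; z<s)
import Data.Nat.Properties as ℕ
open import Data.Sum.Base using (_⊎_; inj₁; inj₂; [_,_]′)
open import Level using (0ℓ)
open import Relation.Binary.PropositionalEquality
  using (_≡_; _≢_; refl; sym; trans; cong; cong₂)
open import Relation.Nullary using (¬_; yes; no)
import Algebra.Definitions.RawMonoid as RawMonoidDefs
import Algebra.Definitions.RawSemiring as RawSemiringDefs

F : ℕ → ℕ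
F 0             = 0
F 1             = 1
F (suc (suc n)) = F (suc n) ℕ.+ F n

-- The iterated operation over a ≤ i ≤ b, equal to the unit when b < a.
module Range {c ℓ} (M : RawMonoid c ℓ) where
  open RawMonoid M using (Carrier)
  open RawMonoidDefs M using (sum)

  range : ℕ → ℕ → (ℕ → Carrier) → Carrier
  range a b f = sum {suc b ∸ a} (λ t → f (a ℕ.+ toℕ t))

------------------------------------------------------------------------
-- ℤ[q]

-- a₀ ∷ a₁ ∷ … ∷ [] is a₀ + a₁ q + …; trailing zeros are allowed, so the
-- equality of polynomials is _≈ₚ_ and not _≡_.
Poly : Set
Poly = List ℤ

coeff : Poly → ℕ → ℤ
coeff []      _       = 0ℤ
coeff (a ∷ p) zero    = a
coeff (a ∷ p) (suc n) = coeff p n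

infix 4 _≈ₚ_ _≉ₚ_
record _≈ₚ_ (p r : Poly) : Set where
  constructor mk≈ₚ
  field
    coeff-≡ : ∀ n → coeff p n ≡ coeff r n
open _≈ₚ_ public

_≉ₚ_ : Poly → Poly → Set
p ≉ₚ r = ¬ (p ≈ₚ r)

infixl 6 _+ₚ_
_+ₚ_ : Poly → Poly → Poly
[]      +ₚ r       = r
(a ∷ p) +ₚ []      = a ∷ p
(a ∷ p) +ₚ (b ∷ r) = (a ℤ.+ b) ∷ (p +ₚ r)

infixl 7 _*ₚ_
_*ₚ_ : Poly → Poly → Poly
[]      *ₚ r = []
(a ∷ p) *ₚ r = map (a ℤ.*_) r +ₚ (0ℤ ∷ p *ₚ r)

0ₚ 1ₚ q : Poly
0ₚ = []
1ₚ = 1ℤ ∷ []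
q  = 0ℤ ∷ 1ℤ ∷ []

Poly-rawSemiring : RawSemiring 0ℓ 0ℓ
Poly-rawSemiring = record
  { Carrier = Poly
  ; _≈_     = _≈ₚ_
  ; _+_     = _+ₚ_
  ; _*_     = _*ₚ_
  ; 0#      = 0ₚ
  ; 1#      = 1ₚ
  }

open RawSemiringDefs Poly-rawSemiring public
  using () renaming (_^_ to infixr 8 _^ₚ_; sum to sumₚ; product to productₚ)

[_]q : ℕ → Poly
[ m ]q = sumₚ {m} (λ i → q ^ₚ toℕ i)

[_]q^_ : ℕ → ℕ → Poly
[ m ]q^ s = sumₚ {m} (λ i → q ^ₚ (s ℕ.* toℕ i))

∏ₚ : ℕ → ℕ → (ℕ → Poly) → Poly
∏ₚ = Range.range (RawSemiring.*-rawMonoid Poly-rawSemiring)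

infix 5 ∏ₚ
syntax ∏ₚ a b (λ i → p) = ∏ₚ[ i ∈ a ⋯ b ] p

[F_]q! : ℕ → Poly
[F n ]q! = ∏ₚ[ i ∈ 1 ⋯ n ] [ F i ]q

------------------------------------------------------------------------
-- ℤ[q] has no zero divisors, so products of denominators are nonzero

coeff-+ₚ : ∀ p r n → coeff (p +ₚ r) n ≡ coeff p n ℤ.+ coeff r n
coeff-+ₚ []      r       n       = sym (ℤ.+-identityˡ (coeff r n))
coeff-+ₚ (a ∷ p) []      n       = sym (ℤ.+-identityʳ (coeff (a ∷ p) n))
coeff-+ₚ (a ∷ p) (b ∷ r) zero    = refl
coeff-+ₚ (a ∷ p) (b ∷ r) (suc n) = coeff-+ₚ p r n

coeff-scale : ∀ a r n → coeff (map (a ℤ.*_) r) n ≡ a ℤ.* coeff r n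
coeff-scale a []      n       = sym (ℤ.*-zeroʳ a)
coeff-scale a (b ∷ r) zero    = refl
coeff-scale a (b ∷ r) (suc n) = coeff-scale a r n

coeff-∷-*ₚ : ∀ a p r n →
  coeff ((a ∷ p) *ₚ r) n ≡ a ℤ.* coeff r n ℤ.+ coeff (0ℤ ∷ p *ₚ r) n
coeff-∷-*ₚ a p r n =
  trans (coeff-+ₚ (map (a ℤ.*_) r) _ n) (cong (ℤ._+ _) (coeff-scale a r n))

coeff-*ₚ-0∷-zero : ∀ p r → coeff (p *ₚ (0ℤ ∷ r)) 0 ≡ 0ℤ
coeff-*ₚ-0∷-zero []      r = refl
coeff-*ₚ-0∷-zero (a ∷ p) r =
  trans (coeff-∷-*ₚ a p (0ℤ ∷ r) 0) (cong (ℤ._+ 0ℤ) (ℤ.*-zeroʳ a))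

coeff-*ₚ-0∷-suc : ∀ p r n → coeff (p *ₚ (0ℤ ∷ r)) (suc n) ≡ coeff (p *ₚ r) n
coeff-*ₚ-0∷-suc []      r n = refl
coeff-*ₚ-0∷-suc (a ∷ p) r n =
  trans (coeff-∷-*ₚ a p (0ℤ ∷ r) (suc n))
 (trans (cong (λ x → a ℤ.* coeff r n ℤ.+ x) (shift n))
        (sym (coeff-∷-*ₚ a p r n)))
  where
  shift : ∀ n → coeff (p *ₚ (0ℤ ∷ r)) n ≡ coeff (0ℤ ∷ p *ₚ r) n
  shift zero    = coeff-*ₚ-0∷-zero p r
  shift (suc n) = coeff-*ₚ-0∷-suc p r n

0∷-≈0 : ∀ {p} → p ≈ₚ 0ₚ → 0ℤ ∷ p ≈ₚ 0ₚ
0∷-≈0 p≈0 = mk≈ₚ λ { zero → refl ; (suc n) → coeff-≡ p≈0 n }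

*ₚ-cancel-nonzero-head : ∀ a p r → a ≢ 0ℤ → (a ∷ p) *ₚ r ≈ₚ 0ₚ → r ≈ₚ 0ₚ
*ₚ-cancel-nonzero-head a p []      a≢0 _  = mk≈ₚ λ _ → refl
*ₚ-cancel-nonzero-head a p (b ∷ r) a≢0 eq
  with ℤ.i*j≡0⇒i≡0∨j≡0 a
         (trans (sym (ℤ.+-identityʳ (a ℤ.* b)))
         (trans (sym (coeff-∷-*ₚ a p (b ∷ r) 0)) (coeff-≡ eq 0)))
... | inj₁ a≡0  = ⊥-elim (a≢0 a≡0)
... | inj₂ refl = 0∷-≈0 (*ₚ-cancel-nonzero-head a p r a≢0
  (mk≈ₚ λ n → trans (sym (coeff-*ₚ-0∷-suc (a ∷ p) r n)) (coeff-≡ eq (suc n))))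

*ₚ-noZeroDivisors : ∀ p r → p *ₚ r ≈ₚ 0ₚ → p ≈ₚ 0ₚ ⊎ r ≈ₚ 0ₚ
*ₚ-noZeroDivisors []      r _  = inj₁ (mk≈ₚ λ _ → refl)
*ₚ-noZeroDivisors (a ∷ p) r eq with a ℤ.≟ 0ℤ
... | no a≢0   = inj₂ (*ₚ-cancel-nonzero-head a p r a≢0 eq)
... | yes refl = [ (λ p≈0 → inj₁ (0∷-≈0 p≈0)) , inj₂ ]′
  (*ₚ-noZeroDivisors p r (mk≈ₚ λ n →
    trans (sym (ℤ.+-identityˡ (coeff (p *ₚ r) n)))
   (trans (sym (coeff-∷-*ₚ 0ℤ p r (suc n))) (coeff-≡ eq (suc n)))))

*ₚ-≉0 : ∀ {p r} → p ≉ₚ 0ₚ → r ≉ₚ 0ₚ → p *ₚ r ≉ₚ 0ₚ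
*ₚ-≉0 {p} {r} p≉0 r≉0 eq = [ p≉0 , r≉0 ]′ (*ₚ-noZeroDivisors p r eq)

1ₚ≉0 : 1ₚ ≉ₚ 0ₚ
1ₚ≉0 eq with () ← coeff-≡ eq 0

productₚ-≉0 : ∀ {n} (f : Fin n → Poly) → (∀ i → f i ≉ₚ 0ₚ) → productₚ f ≉ₚ 0ₚ
productₚ-≉0 {zero}  f f≉0 = 1ₚ≉0
productₚ-≉0 {suc n} f f≉0 =
  *ₚ-≉0 (f≉0 Fin.zero) (productₚ-≉0 (λ i → f (Fin.suc i)) (λ i → f≉0 (Fin.suc i)))

coeff-sumₚ-zero : ∀ {n} (f : Fin n → Poly) →
  (∀ i → coeff (f i) 0 ≡ 0ℤ) → coeff (sumₚ f) 0 ≡ 0ℤ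
coeff-sumₚ-zero {zero}  f f₀≡0 = refl
coeff-sumₚ-zero {suc n} f f₀≡0 =
  trans (coeff-+ₚ (f Fin.zero) _ 0)
        (cong₂ ℤ._+_ (f₀≡0 Fin.zero)
          (coeff-sumₚ-zero (λ i → f (Fin.suc i)) (λ i → f₀≡0 (Fin.suc i))))

coeff-q*-zero : ∀ p → coeff (q *ₚ p) 0 ≡ 0ℤ
coeff-q*-zero p = trans (coeff-∷-*ₚ 0ℤ 1ₚ p 0) (ℤ.+-identityʳ _)

coeff-[]q-zero : ∀ m → coeff [ suc m ]q 0 ≡ 1ℤ
coeff-[]q-zero m =
  trans (coeff-+ₚ 1ₚ (sumₚ f) 0)
        (cong (λ x → 1ℤ ℤ.+ x)
          (coeff-sumₚ-zero f (λ i → coeff-q*-zero (q ^ₚ toℕ i))))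
  where
  f : Fin m → Poly
  f i = q ^ₚ toℕ (Fin.suc i)

[]q-≉0 : ∀ {m} → 0 < m → [ m ]q ≉ₚ 0ₚ
[]q-≉0 {suc m} _ eq with () ← trans (sym (coeff-[]q-zero m)) (coeff-≡ eq 0)

F-suc>0 : ∀ n → 0 < F (suc n)
F-suc>0 zero    = z<s
F-suc>0 (suc n) = ℕ.<-≤-trans (F-suc>0 n) (ℕ.m≤m+n _ _)

[F]q!-≉0 : ∀ n → [F n ]q! ≉ₚ 0ₚ
[F]q!-≉0 n = productₚ-≉0 {n} _ (λ i → []q-≉0 (F-suc>0 (toℕ i)))

------------------------------------------------------------------------
-- ℚ(q), as the field of fractions of ℤ[q]

record RatFun : Set where
  constructor mkRatFun
  field
    num   : Poly
    den   : Poly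
    den≉0 : den ≉ₚ 0ₚ
open RatFun public

infix 4 _≈_
record _≈_ (x y : RatFun) : Set where
  constructor mk≈
  field
    cross : num x *ₚ den y ≈ₚ num y *ₚ den x
open _≈_ public

infixl 6 _+_
_+_ : RatFun → RatFun → RatFun
x + y = mkRatFun (num x *ₚ den y +ₚ num y *ₚ den x) (den x *ₚ den y)
                 (*ₚ-≉0 (den≉0 x) (den≉0 y))

infixl 7 _*_
_*_ : RatFun → RatFun → RatFun
x * y = mkRatFun (num x *ₚ num y) (den x *ₚ den y) (*ₚ-≉0 (den≉0 x) (den≉0 y))

ι : Poly → RatFun
ι p = mkRatFun p 1ₚ 1ₚ≉0

RatFun-rawSemiring : RawSemiring 0ℓ 0ℓ
RatFun-rawSemiring = record
  { Carrier = RatFun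
  ; _≈_     = _≈_
  ; _+_     = _+_
  ; _*_     = _*_
  ; 0#      = ι 0ₚ
  ; 1#      = ι 1ₚ
  }

∑ : ℕ → ℕ → (ℕ → RatFun) → RatFun
∑ = Range.range (RawSemiring.+-rawMonoid RatFun-rawSemiring)

infix 5 ∑
syntax ∑ a b (λ i → x) = ∑[ i ∈ a ⋯ b ] x

∑ℕ : ℕ → ℕ → (ℕ → ℕ) → ℕ
∑ℕ = Range.range ℕ.+-0-rawMonoid

infix 5 ∑ℕ
syntax ∑ℕ a b (λ i → m) = ∑ℕ[ i ∈ a ⋯ b ] m

-- Only meaningful for k ≤ n, because of the truncated subtraction.
qFibonomial : ℕ → ℕ → RatFun
qFibonomial n k = mkRatFun [F n ]q! ([F k ]q! *ₚ [F n ∸ k ]q!)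
                           (*ₚ-≉0 ([F]q!-≉0 k) ([F]q!-≉0 (n ∸ k)))

{-# OPTIONS --safe #-}

-- Put d = n ∸ k.  From F n = F d · F (k + 1) + F k · F (d ∸ 1) one gets
--   [F n]_q = [F d]_q [F (k + 1)]_{q^F d} + q^(F d · F (k + 1)) [F k]_q [F (d ∸ 1)]_{q^F k},
-- hence a Pascal-type rule expressing (n , k) through (n ∸ 1 , k) and
-- (n ∸ 1 , k ∸ 1).  The latter leaves d unchanged, so iterating the rule
-- on that term alone unfolds into the sum.

module Submission where

open import Defs
open import Data.Nat.Base as ℕ using (ℕ; _∸_; _≤_; zero; suc; s≤s)

open import Algebra.Bundles using (CommutativeRing; CommutativeSemiring)
open import Algebra.Structures.Biased _≈_
  using (isCommutativeMonoidˡ; isCommutativeSemiringˡ)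
open import Data.Empty using (⊥-elim)
open import Data.Fin.Base as Fin using (toℕ)
import Data.Fin.Properties as Fin
open import Data.Integer.Base as ℤ using (0ℤ; 1ℤ)
import Data.Integer.Properties as ℤ
open import Data.Integer.Solver using (module +-*-Solver)
open import Data.List.Base using ([]; _∷_; map)
import Data.Nat.Properties as ℕ
import Data.Nat.Tactic.RingSolver as ℕ-RingSolver
open import Data.Product.Base using (_,_)
open import Data.Sum.Base using (inj₁; inj₂)
open import Function.Base using (_∘_)
open import Level using (0ℓ)
open import Relation.Binary.Structures using (IsEquivalence)
open import Relation.Binary.PropositionalEquality
  using (_≡_; refl; sym; trans; cong; cong₂; module ≡-Reasoning)
import Algebra.Properties.Monoid.Sum as MonoidSum
import Algebra.Properties.Ring as RingProperties
import Algebra.Properties.Semiring.Exp as SemiringExp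
import Algebra.Properties.Semiring.Sum as SemiringSum
import Algebra.Solver.Ring.NaturalCoefficients.Default as SemiringSolver
import Relation.Binary.Reasoning.Setoid as SetoidReasoning

-- The commutative ring ℤ[q]

infix 8 -ₚ_
-ₚ_ : Poly → Poly
-ₚ_ = map (λ a → ℤ.- a)

coeff--ₚ : ∀ p n → coeff (-ₚ p) n ≡ ℤ.- coeff p n
coeff--ₚ []      n       = refl
coeff--ₚ (a ∷ p) zero    = refl
coeff--ₚ (a ∷ p) (suc n) = coeff--ₚ p n

-- Prefixing `0ℤ` is multiplication by q. The ring laws are first proved coefficient by coefficient,
-- so that each induction step becomes an identity in ℤ; the `coeff-0∷` lemmas carry the induction
-- hypothesis through this shift.
coeff-0∷-cong : ∀ {p r} → (∀ n → coeff p n ≡ coeff r n) →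
  ∀ n → coeff (0ℤ ∷ p) n ≡ coeff (0ℤ ∷ r) n
coeff-0∷-cong p≡r zero    = refl
coeff-0∷-cong p≡r (suc n) = p≡r n

coeff-0∷-+ₚ : ∀ p r n →
  coeff (0ℤ ∷ (p +ₚ r)) n ≡ coeff (0ℤ ∷ p) n ℤ.+ coeff (0ℤ ∷ r) n
coeff-0∷-+ₚ p r zero    = refl
coeff-0∷-+ₚ p r (suc n) = coeff-+ₚ p r n

coeff-0∷-scale : ∀ a p n →
  coeff (0ℤ ∷ map (a ℤ.*_) p) n ≡ a ℤ.* coeff (0ℤ ∷ p) n
coeff-0∷-scale a p zero    = sym (ℤ.*-zeroʳ a)
coeff-0∷-scale a p (suc n) = coeff-scale a p n

coeff-*ₚ-[] : ∀ p n → coeff (p *ₚ []) n ≡ 0ℤ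
coeff-*ₚ-[] []      n       = refl
coeff-*ₚ-[] (a ∷ p) zero    = refl
coeff-*ₚ-[] (a ∷ p) (suc n) = coeff-*ₚ-[] p n

-- The mirror image of `coeff-∷-*ₚ`: `_*ₚ_` recurses on its left factor only, and this recovers the
-- same expansion along the right factor.
coeff-*ₚ-∷ : ∀ p b r n →
  coeff (p *ₚ (b ∷ r)) n ≡ b ℤ.* coeff p n ℤ.+ coeff (0ℤ ∷ p *ₚ r) n
coeff-*ₚ-∷ []      b r zero    = sym (trans (ℤ.+-identityʳ _) (ℤ.*-zeroʳ b))
coeff-*ₚ-∷ []      b r (suc n) = sym (trans (ℤ.+-identityʳ _) (ℤ.*-zeroʳ b))
coeff-*ₚ-∷ (a ∷ p) b r zero    = begin
  coeff ((a ∷ p) *ₚ (b ∷ r)) 0  ≡⟨ coeff-∷-*ₚ a p (b ∷ r) 0 ⟩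
  a ℤ.* b ℤ.+ 0ℤ                ≡⟨ cong (ℤ._+ 0ℤ) (ℤ.*-comm a b) ⟩
  b ℤ.* a ℤ.+ 0ℤ                ∎
  where open ≡-Reasoning
coeff-*ₚ-∷ (a ∷ p) b r (suc n) = begin
  coeff ((a ∷ p) *ₚ (b ∷ r)) (suc n)
    ≡⟨ coeff-∷-*ₚ a p (b ∷ r) (suc n) ⟩
  a ℤ.* coeff r n ℤ.+ coeff (p *ₚ (b ∷ r)) n
    ≡⟨ cong (λ x → a ℤ.* coeff r n ℤ.+ x) (coeff-*ₚ-∷ p b r n) ⟩
  a ℤ.* coeff r n ℤ.+ (b ℤ.* coeff p n ℤ.+ coeff (0ℤ ∷ p *ₚ r) n)
    ≡⟨ solve 3 (λ x y z → x :+ (y :+ z) := y :+ (x :+ z)) refl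
         (a ℤ.* coeff r n) (b ℤ.* coeff p n) (coeff (0ℤ ∷ p *ₚ r) n) ⟩
  b ℤ.* coeff p n ℤ.+ (a ℤ.* coeff r n ℤ.+ coeff (0ℤ ∷ p *ₚ r) n)
    ≡⟨ cong (λ x → b ℤ.* coeff p n ℤ.+ x) (coeff-∷-*ₚ a p r n) ⟨
  b ℤ.* coeff p n ℤ.+ coeff ((a ∷ p) *ₚ r) n ∎
  where
  open ≡-Reasoning
  open +-*-Solver

-- Expanding `a ∷ p` as a left factor and as a right factor gives the same head term `a · r`, and
-- the tails agree by induction.
coeff-*ₚ-comm : ∀ p r n → coeff (p *ₚ r) n ≡ coeff (r *ₚ p) n
coeff-*ₚ-comm []      r n = sym (coeff-*ₚ-[] r n)
coeff-*ₚ-comm (a ∷ p) r n = begin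
  coeff ((a ∷ p) *ₚ r) n
    ≡⟨ coeff-∷-*ₚ a p r n ⟩
  a ℤ.* coeff r n ℤ.+ coeff (0ℤ ∷ p *ₚ r) n
    ≡⟨ cong (λ x → a ℤ.* coeff r n ℤ.+ x)
         (coeff-0∷-cong {p *ₚ r} {r *ₚ p} (coeff-*ₚ-comm p r) n) ⟩
  a ℤ.* coeff r n ℤ.+ coeff (0ℤ ∷ r *ₚ p) n
    ≡⟨ coeff-*ₚ-∷ r a p n ⟨
  coeff (r *ₚ (a ∷ p)) n ∎
  where open ≡-Reasoning

coeff-*ₚ-congˡ : ∀ p {r s} → (∀ n → coeff r n ≡ coeff s n) →
  ∀ n → coeff (p *ₚ r) n ≡ coeff (p *ₚ s) n
coeff-*ₚ-congˡ []      r≡s n = refl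
coeff-*ₚ-congˡ (a ∷ p) {r} {s} r≡s n = begin
  coeff ((a ∷ p) *ₚ r) n
    ≡⟨ coeff-∷-*ₚ a p r n ⟩
  a ℤ.* coeff r n ℤ.+ coeff (0ℤ ∷ p *ₚ r) n
    ≡⟨ cong₂ (λ x y → a ℤ.* x ℤ.+ y) (r≡s n)
         (coeff-0∷-cong {p *ₚ r} {p *ₚ s} (coeff-*ₚ-congˡ p r≡s) n) ⟩
  a ℤ.* coeff s n ℤ.+ coeff (0ℤ ∷ p *ₚ s) n
    ≡⟨ coeff-∷-*ₚ a p s n ⟨
  coeff ((a ∷ p) *ₚ s) n ∎
  where open ≡-Reasoning

coeff-*ₚ-distribˡ : ∀ p r s n →
  coeff (p *ₚ (r +ₚ s)) n ≡ coeff (p *ₚ r) n ℤ.+ coeff (p *ₚ s) n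
coeff-*ₚ-distribˡ []      r s n = refl
coeff-*ₚ-distribˡ (a ∷ p) r s n = begin
  coeff ((a ∷ p) *ₚ (r +ₚ s)) n
    ≡⟨ coeff-∷-*ₚ a p (r +ₚ s) n ⟩
  a ℤ.* coeff (r +ₚ s) n ℤ.+ coeff (0ℤ ∷ p *ₚ (r +ₚ s)) n
    ≡⟨ cong₂ (λ x y → a ℤ.* x ℤ.+ y) (coeff-+ₚ r s n)
         (trans (coeff-0∷-cong {p *ₚ (r +ₚ s)} {p *ₚ r +ₚ p *ₚ s}
                   (λ m → trans (coeff-*ₚ-distribˡ p r s m)
                                (sym (coeff-+ₚ (p *ₚ r) (p *ₚ s) m))) n)
                (coeff-0∷-+ₚ (p *ₚ r) (p *ₚ s) n)) ⟩
  a ℤ.* (coeff r n ℤ.+ coeff s n)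
    ℤ.+ (coeff (0ℤ ∷ p *ₚ r) n ℤ.+ coeff (0ℤ ∷ p *ₚ s) n)
    ≡⟨ solve 5 (λ a r s x y → a :* (r :+ s) :+ (x :+ y)
                              := (a :* r :+ x) :+ (a :* s :+ y)) refl
         a (coeff r n) (coeff s n)
         (coeff (0ℤ ∷ p *ₚ r) n) (coeff (0ℤ ∷ p *ₚ s) n) ⟩
  (a ℤ.* coeff r n ℤ.+ coeff (0ℤ ∷ p *ₚ r) n)
    ℤ.+ (a ℤ.* coeff s n ℤ.+ coeff (0ℤ ∷ p *ₚ s) n)
    ≡⟨ cong₂ ℤ._+_ (coeff-∷-*ₚ a p r n) (coeff-∷-*ₚ a p s n) ⟨
  coeff ((a ∷ p) *ₚ r) n ℤ.+ coeff ((a ∷ p) *ₚ s) n ∎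
  where
  open ≡-Reasoning
  open +-*-Solver

coeff-*ₚ-distribʳ : ∀ s p r n →
  coeff ((p +ₚ r) *ₚ s) n ≡ coeff (p *ₚ s) n ℤ.+ coeff (r *ₚ s) n
coeff-*ₚ-distribʳ s p r n = begin
  coeff ((p +ₚ r) *ₚ s) n                  ≡⟨ coeff-*ₚ-comm (p +ₚ r) s n ⟩
  coeff (s *ₚ (p +ₚ r)) n                  ≡⟨ coeff-*ₚ-distribˡ s p r n ⟩
  coeff (s *ₚ p) n ℤ.+ coeff (s *ₚ r) n
    ≡⟨ cong₂ ℤ._+_ (coeff-*ₚ-comm s p n) (coeff-*ₚ-comm s r n) ⟩
  coeff (p *ₚ s) n ℤ.+ coeff (r *ₚ s) n    ∎
  where open ≡-Reasoning

-- Associativity for a constant first factor. Together with `coeff-0∷-*ₚ`, which lets a factor q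
-- pass through a product, it handles the two halves of `(a ∷ p) *ₚ r` in the proof of
-- associativity.
coeff-scale-*ₚ : ∀ a p r n →
  coeff (map (a ℤ.*_) p *ₚ r) n ≡ a ℤ.* coeff (p *ₚ r) n
coeff-scale-*ₚ a []      r n = sym (ℤ.*-zeroʳ a)
coeff-scale-*ₚ a (b ∷ p) r n = begin
  coeff ((a ℤ.* b ∷ map (a ℤ.*_) p) *ₚ r) n
    ≡⟨ coeff-∷-*ₚ (a ℤ.* b) (map (a ℤ.*_) p) r n ⟩
  a ℤ.* b ℤ.* coeff r n ℤ.+ coeff (0ℤ ∷ map (a ℤ.*_) p *ₚ r) n
    ≡⟨ cong (λ x → a ℤ.* b ℤ.* coeff r n ℤ.+ x)
         (trans (coeff-0∷-cong {map (a ℤ.*_) p *ₚ r} {map (a ℤ.*_) (p *ₚ r)}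
                   (λ m → trans (coeff-scale-*ₚ a p r m)
                                (sym (coeff-scale a (p *ₚ r) m))) n)
                (coeff-0∷-scale a (p *ₚ r) n)) ⟩
  a ℤ.* b ℤ.* coeff r n ℤ.+ a ℤ.* coeff (0ℤ ∷ p *ₚ r) n
    ≡⟨ solve 4 (λ a b r x → a :* b :* r :+ a :* x := a :* (b :* r :+ x)) refl
         a b (coeff r n) (coeff (0ℤ ∷ p *ₚ r) n) ⟩
  a ℤ.* (b ℤ.* coeff r n ℤ.+ coeff (0ℤ ∷ p *ₚ r) n)
    ≡⟨ cong (a ℤ.*_) (coeff-∷-*ₚ b p r n) ⟨
  a ℤ.* coeff ((b ∷ p) *ₚ r) n ∎
  where
  open ≡-Reasoning
  open +-*-Solver

coeff-0∷-*ₚ : ∀ p r n → coeff ((0ℤ ∷ p) *ₚ r) n ≡ coeff (0ℤ ∷ p *ₚ r) n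
coeff-0∷-*ₚ p r n =
  trans (coeff-∷-*ₚ 0ℤ p r n) (ℤ.+-identityˡ (coeff (0ℤ ∷ p *ₚ r) n))

coeff-*ₚ-assoc : ∀ p r s n → coeff (p *ₚ r *ₚ s) n ≡ coeff (p *ₚ (r *ₚ s)) n
coeff-*ₚ-assoc []      r s n = refl
coeff-*ₚ-assoc (a ∷ p) r s n = begin
  coeff ((map (a ℤ.*_) r +ₚ (0ℤ ∷ p *ₚ r)) *ₚ s) n
    ≡⟨ coeff-*ₚ-distribʳ s (map (a ℤ.*_) r) (0ℤ ∷ p *ₚ r) n ⟩
  coeff (map (a ℤ.*_) r *ₚ s) n ℤ.+ coeff ((0ℤ ∷ p *ₚ r) *ₚ s) n
    ≡⟨ cong₂ ℤ._+_ (coeff-scale-*ₚ a r s n)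
         (trans (coeff-0∷-*ₚ (p *ₚ r) s n)
                (coeff-0∷-cong {p *ₚ r *ₚ s} {p *ₚ (r *ₚ s)}
                   (coeff-*ₚ-assoc p r s) n)) ⟩
  a ℤ.* coeff (r *ₚ s) n ℤ.+ coeff (0ℤ ∷ p *ₚ (r *ₚ s)) n
    ≡⟨ coeff-∷-*ₚ a p (r *ₚ s) n ⟨
  coeff ((a ∷ p) *ₚ (r *ₚ s)) n ∎
  where open ≡-Reasoning

coeff-1ₚ*ₚ : ∀ p n → coeff (1ₚ *ₚ p) n ≡ coeff p n
coeff-1ₚ*ₚ p n = begin
  coeff (1ₚ *ₚ p) n
    ≡⟨ coeff-∷-*ₚ 1ℤ [] p n ⟩
  1ℤ ℤ.* coeff p n ℤ.+ coeff (0ℤ ∷ []) n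
    ≡⟨ cong₂ ℤ._+_ (ℤ.*-identityˡ (coeff p n))
         -- `1ₚ *ₚ p` leaves the remainder `0ℤ ∷ []`, which is zero only up to trailing zeros.
         (coeff-≡ (0∷-≈0 {[]} (mk≈ₚ λ _ → refl)) n) ⟩
  coeff p n ℤ.+ 0ℤ
    ≡⟨ ℤ.+-identityʳ (coeff p n) ⟩
  coeff p n ∎
  where open ≡-Reasoning

Poly-commutativeRing : CommutativeRing 0ℓ 0ℓ
Poly-commutativeRing = record
  { Carrier = Poly
  ; _≈_     = _≈ₚ_
  ; _+_     = _+ₚ_
  ; _*_     = _*ₚ_
  ; -_      = -ₚ_
  ; 0#      = 0ₚ
  ; 1#      = 1ₚ
  ; isCommutativeRing = record
    { isRing = record
      { +-isAbelianGroup = record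
        { isGroup = record
          { isMonoid = record
            { isSemigroup = record
              { isMagma = record
                { isEquivalence = record
                  { refl  = mk≈ₚ λ n → refl
                  ; sym   = λ e → mk≈ₚ λ n → sym (coeff-≡ e n)
                  ; trans = λ e f → mk≈ₚ λ n → trans (coeff-≡ e n) (coeff-≡ f n)
                  }
                ; ∙-cong = λ {p} {r} {s} {t} e f → mk≈ₚ λ n →
                    trans (coeff-+ₚ p s n)
                   (trans (cong₂ ℤ._+_ (coeff-≡ e n) (coeff-≡ f n))
                          (sym (coeff-+ₚ r t n)))
                }
              ; assoc = λ p r s → mk≈ₚ λ n →
                  trans (coeff-+ₚ (p +ₚ r) s n)
                 (trans (cong (ℤ._+ _) (coeff-+ₚ p r n))
                 (trans (ℤ.+-assoc (coeff p n) _ _)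
                 (trans (cong (λ x → coeff p n ℤ.+ x) (sym (coeff-+ₚ r s n)))
                        (sym (coeff-+ₚ p (r +ₚ s) n)))))
              }
            ; identity = (λ p → mk≈ₚ λ n → refl)
                       , (λ p → mk≈ₚ λ n →
                            trans (coeff-+ₚ p [] n) (ℤ.+-identityʳ _))
            }
          ; inverse = (λ p → mk≈ₚ λ n →
                         trans (coeff-+ₚ (-ₚ p) p n)
                        (trans (cong (ℤ._+ coeff p n) (coeff--ₚ p n))
                               (ℤ.+-inverseˡ (coeff p n))))
                    , (λ p → mk≈ₚ λ n →
                         trans (coeff-+ₚ p (-ₚ p) n)
                        (trans (cong (λ x → coeff p n ℤ.+ x) (coeff--ₚ p n))
                               (ℤ.+-inverseʳ (coeff p n))))
          ; ⁻¹-cong = λ {p} {r} e → mk≈ₚ λ n →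
              trans (coeff--ₚ p n)
             (trans (cong (λ a → ℤ.- a) (coeff-≡ e n)) (sym (coeff--ₚ r n)))
          }
        ; comm = λ p r → mk≈ₚ λ n →
            trans (coeff-+ₚ p r n)
           (trans (ℤ.+-comm (coeff p n) _) (sym (coeff-+ₚ r p n)))
        }
      ; *-cong = λ {p} {r} {s} {t} e f → mk≈ₚ λ n →
          trans (coeff-*ₚ-congˡ p (coeff-≡ f) n)
         -- Congruence is proved directly in the right factor; for the left factor it is transported
         -- by commutativity.
         (trans (coeff-*ₚ-comm p t n)
         (trans (coeff-*ₚ-congˡ t (coeff-≡ e) n) (coeff-*ₚ-comm t r n)))
      ; *-assoc = λ p r s → mk≈ₚ (coeff-*ₚ-assoc p r s)
      ; *-identity = (λ p → mk≈ₚ (coeff-1ₚ*ₚ p))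
                   , (λ p → mk≈ₚ λ n → trans (coeff-*ₚ-comm p 1ₚ n) (coeff-1ₚ*ₚ p n))
      ; distrib = (λ p r s → mk≈ₚ λ n →
                     trans (coeff-*ₚ-distribˡ p r s n)
                           (sym (coeff-+ₚ (p *ₚ r) (p *ₚ s) n)))
                , (λ s p r → mk≈ₚ λ n →
                     trans (coeff-*ₚ-distribʳ s p r n)
                           (sym (coeff-+ₚ (p *ₚ s) (r *ₚ s) n)))
      }
    ; *-comm = λ p r → mk≈ₚ (coeff-*ₚ-comm p r)
    }
  }

module P = CommutativeRing Poly-commutativeRing

-- The library's congˡ and congʳ leave the unchanged operand implicit, and it
-- cannot be inferred here because the operations compute.

+ₚ-congˡ : ∀ p {r s} → r ≈ₚ s → p +ₚ r ≈ₚ p +ₚ s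
+ₚ-congˡ p = P.+-congˡ {p}

*ₚ-congˡ : ∀ p {r s} → r ≈ₚ s → p *ₚ r ≈ₚ p *ₚ s
*ₚ-congˡ p = P.*-congˡ {p}

*ₚ-congʳ : ∀ p {r s} → r ≈ₚ s → r *ₚ p ≈ₚ s *ₚ p
*ₚ-congʳ p = P.*-congʳ {p}

module PolySolver = SemiringSolver P.commutativeSemiring

-- `(p - r) d` vanishes, and ℤ[q] has no zero divisors.
*ₚ-cancelʳ : ∀ {p r} d → d ≉ₚ 0ₚ → p *ₚ d ≈ₚ r *ₚ d → p ≈ₚ r
*ₚ-cancelʳ {p} {r} d d≉0 pd≈rd
  with *ₚ-noZeroDivisors (p P.- r) d
         (P.trans ([y-z]x≈yx-zx d p r) (x≈y⇒x∙y⁻¹≈ε pd≈rd))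
  where open RingProperties P.ring using ([y-z]x≈yx-zx; x≈y⇒x∙y⁻¹≈ε)
... | inj₁ p-r≈0 = RingProperties.x∙y⁻¹≈ε⇒x≈y P.ring p r p-r≈0
... | inj₂ d≈0   = ⊥-elim (d≉0 d≈0)

-- The commutative semiring ℚ(q)

-- Chaining the two cross-multiplied equations proves the desired one only after multiplication by
-- `den y`; this factor is nonzero and cancels.
≈-trans : ∀ {x y z} → x ≈ y → y ≈ z → x ≈ z
≈-trans {x} {y} {z} x≈y y≈z = mk≈ (*ₚ-cancelʳ (den y) (den≉0 y) (begin
  num x *ₚ den z *ₚ den y  ≈⟨ swap (num x) (den z) (den y) ⟩
  num x *ₚ den y *ₚ den z  ≈⟨ P.*-congʳ (cross x≈y) ⟩
  num y *ₚ den x *ₚ den z  ≈⟨ swap (num y) (den x) (den z) ⟩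
  num y *ₚ den z *ₚ den x  ≈⟨ P.*-congʳ (cross y≈z) ⟩
  num z *ₚ den y *ₚ den x  ≈⟨ swap (num z) (den y) (den x) ⟩
  num z *ₚ den x *ₚ den y  ∎))
  where
  open SetoidReasoning P.setoid
  open PolySolver
  swap : ∀ a b c → a *ₚ b *ₚ c ≈ₚ a *ₚ c *ₚ b
  swap = solve 3 (λ a b c → a :* b :* c := a :* c :* b) P.refl

+-cong : ∀ {x y u v} → x ≈ y → u ≈ v → x + u ≈ y + v
+-cong {x} {y} {u} {v} x≈y u≈v = mk≈ (begin
  (num x *ₚ den u +ₚ num u *ₚ den x) *ₚ (den y *ₚ den v)
    ≈⟨ expand (num x) (den x) (num u) (den u) (den y) (den v) ⟩
  num x *ₚ den y *ₚ (den u *ₚ den v) +ₚ num u *ₚ den v *ₚ (den x *ₚ den y)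
    ≈⟨ P.+-cong (P.*-congʳ (cross x≈y)) (P.*-congʳ (cross u≈v)) ⟩
  num y *ₚ den x *ₚ (den u *ₚ den v) +ₚ num v *ₚ den u *ₚ (den x *ₚ den y)
    ≈⟨ collect (num y) (den y) (num v) (den v) (den x) (den u) ⟩
  (num y *ₚ den v +ₚ num v *ₚ den y) *ₚ (den x *ₚ den u) ∎)
  where
  open SetoidReasoning P.setoid
  open PolySolver
  expand : ∀ a b c d e f → (a *ₚ d +ₚ c *ₚ b) *ₚ (e *ₚ f)
                         ≈ₚ a *ₚ e *ₚ (d *ₚ f) +ₚ c *ₚ f *ₚ (b *ₚ e)
  expand = solve 6 (λ a b c d e f → (a :* d :+ c :* b) :* (e :* f)
                                  := a :* e :* (d :* f) :+ c :* f :* (b :* e)) P.refl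
  collect : ∀ a b c d e f → a *ₚ e *ₚ (f *ₚ d) +ₚ c *ₚ f *ₚ (e *ₚ b)
                          ≈ₚ (a *ₚ d +ₚ c *ₚ b) *ₚ (e *ₚ f)
  collect = solve 6 (λ a b c d e f → a :* e :* (f :* d) :+ c :* f :* (e :* b)
                                   := (a :* d :+ c :* b) :* (e :* f)) P.refl

*-cong : ∀ {x y u v} → x ≈ y → u ≈ v → x * u ≈ y * v
*-cong {x} {y} {u} {v} x≈y u≈v = mk≈ (begin
  num x *ₚ num u *ₚ (den y *ₚ den v)    ≈⟨ interchange (num x) (num u) (den y) (den v) ⟩
  num x *ₚ den y *ₚ (num u *ₚ den v)    ≈⟨ P.*-cong (cross x≈y) (cross u≈v) ⟩
  num y *ₚ den x *ₚ (num v *ₚ den u)    ≈⟨ interchange (num y) (den x) (num v) (den u) ⟩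
  num y *ₚ num v *ₚ (den x *ₚ den u)    ∎)
  where
  open SetoidReasoning P.setoid
  open PolySolver
  interchange : ∀ a b c d → a *ₚ b *ₚ (c *ₚ d) ≈ₚ a *ₚ c *ₚ (b *ₚ d)
  interchange = solve 4 (λ a b c d → a :* b :* (c :* d) := a :* c :* (b :* d)) P.refl

-- Apart from the equivalence and the congruences, each law is, after cross-multiplication, a
-- polynomial identity with numerators and denominators as independent variables.
RatFun-commutativeSemiring : CommutativeSemiring 0ℓ 0ℓ
RatFun-commutativeSemiring = record
  { Carrier = RatFun
  ; _≈_     = _≈_
  ; _+_     = _+_
  ; _*_     = _*_
  ; 0#      = ι 0ₚ
  ; 1#      = ι 1ₚ
  ; isCommutativeSemiring = isCommutativeSemiringˡ record
    { +-isCommutativeMonoid = isCommutativeMonoidˡ record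
      { isSemigroup = record
        { isMagma = record { isEquivalence = isEquivalence ; ∙-cong = +-cong }
        ; assoc = λ x y z → mk≈
            (solve 6 (λ a a′ b b′ c c′ →
               ((a :* b′ :+ b :* a′) :* c′ :+ c :* (a′ :* b′)) :* (a′ :* (b′ :* c′))
               := (a :* (b′ :* c′) :+ (b :* c′ :+ c :* b′) :* a′) :* (a′ :* b′ :* c′))
             P.refl (num x) (den x) (num y) (den y) (num z) (den z))
        }
      ; identityˡ = λ x → mk≈
          (solve 2 (λ a a′ → (con 0 :* a′ :+ a :* con 1) :* a′ := a :* (con 1 :* a′))
           P.refl (num x) (den x))
      ; comm = λ x y → mk≈
          (solve 4 (λ a a′ b b′ → (a :* b′ :+ b :* a′) :* (b′ :* a′)
                               := (b :* a′ :+ a :* b′) :* (a′ :* b′))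
           P.refl (num x) (den x) (num y) (den y))
      }
    ; *-isCommutativeMonoid = isCommutativeMonoidˡ record
      { isSemigroup = record
        { isMagma = record { isEquivalence = isEquivalence ; ∙-cong = *-cong }
        ; assoc = λ x y z → mk≈
            (solve 6 (λ a a′ b b′ c c′ →
               a :* b :* c :* (a′ :* (b′ :* c′)) := a :* (b :* c) :* (a′ :* b′ :* c′))
             P.refl (num x) (den x) (num y) (den y) (num z) (den z))
        }
      ; identityˡ = λ x → mk≈
          (solve 2 (λ a a′ → con 1 :* a :* a′ := a :* (con 1 :* a′))
           P.refl (num x) (den x))
      ; comm = λ x y → mk≈
          (solve 4 (λ a a′ b b′ → a :* b :* (b′ :* a′) := b :* a :* (a′ :* b′))
           P.refl (num x) (den x) (num y) (den y))
      }
    ; distribʳ = λ z x y → mk≈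
        (solve 6 (λ a a′ b b′ c c′ →
           (a :* b′ :+ b :* a′) :* c :* (a′ :* c′ :* (b′ :* c′))
           := (a :* c :* (b′ :* c′) :+ b :* c :* (a′ :* c′)) :* (a′ :* b′ :* c′))
         P.refl (num x) (den x) (num y) (den y) (num z) (den z))
    ; zeroˡ = λ x → mk≈
        (solve 2 (λ a a′ → con 0 :* a :* con 1 := con 0 :* (con 1 :* a′))
         P.refl (num x) (den x))
    }
  }
  where
  open PolySolver
  isEquivalence : IsEquivalence _≈_
  isEquivalence = record
    { refl  = mk≈ P.refl
    ; sym   = λ x≈y → mk≈ (P.sym (cross x≈y))
    ; trans = ≈-trans
    }

module R = CommutativeSemiring RatFun-commutativeSemiring

+-congˡ : ∀ x {y z} → y ≈ z → x + y ≈ x + z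
+-congˡ x = R.+-congˡ {x}

*-congˡ : ∀ x {y z} → y ≈ z → x * y ≈ x * z
*-congˡ x = R.*-congˡ {x}

*-congʳ : ∀ x {y z} → y ≈ z → y * x ≈ z * x
*-congʳ x = R.*-congʳ {x}

module RatFunSolver = SemiringSolver RatFun-commutativeSemiring

ι-cong : ∀ {p r} → p ≈ₚ r → ι p ≈ ι r
ι-cong p≈r = mk≈ (P.*-congʳ p≈r)

ι-*ₚ : ∀ p r → ι (p *ₚ r) ≈ ι p * ι r
ι-*ₚ p r = mk≈ (solve 2 (λ p r → p :* r :* (con 1 :* con 1) := p :* r :* con 1) P.refl p r)
  where open PolySolver

-- q-numbers and the q-analogue of the addition formula for F

open SemiringExp P.semiring using (^-congʳ; ^-homo-*)

[suc]q^ : ∀ m s → [ suc m ]q^ s ≈ₚ 1ₚ +ₚ q ^ₚ s *ₚ [ m ]q^ s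
[suc]q^ m s = P.+-cong (^-congʳ q (ℕ.*-zeroʳ s)) (begin
  sumₚ {m} (λ i → q ^ₚ (s ℕ.* suc (toℕ i)))
    ≈⟨ sum-cong-≋ {m} (λ i → P.trans (^-congʳ q (ℕ.*-suc s (toℕ i)))
                                     (^-homo-* q s (s ℕ.* toℕ i))) ⟩
  sumₚ {m} (λ i → q ^ₚ s *ₚ q ^ₚ (s ℕ.* toℕ i))
    ≈⟨ *-distribˡ-sum {m} (q ^ₚ s) (λ i → q ^ₚ (s ℕ.* toℕ i)) ⟨
  q ^ₚ s *ₚ [ m ]q^ s ∎)
  where
  open SetoidReasoning P.setoid
  open SemiringSum P.semiring

-- The geometric sum is cut after its first `a` terms; the remaining `b` terms share the factor
-- `q ^ₚ (s * a)`.
[+]q^ : ∀ a b s → [ a ℕ.+ b ]q^ s ≈ₚ [ a ]q^ s +ₚ q ^ₚ (s ℕ.* a) *ₚ [ b ]q^ s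
[+]q^ zero    b s = P.sym (begin
  q ^ₚ (s ℕ.* 0) *ₚ [ b ]q^ s  ≈⟨ *ₚ-congʳ ([ b ]q^ s) (^-congʳ q (ℕ.*-zeroʳ s)) ⟩
  1ₚ *ₚ [ b ]q^ s              ≈⟨ P.*-identityˡ _ ⟩
  [ b ]q^ s                    ∎)
  where open SetoidReasoning P.setoid
[+]q^ (suc a) b s = begin
  [ suc (a ℕ.+ b) ]q^ s
    ≈⟨ [suc]q^ (a ℕ.+ b) s ⟩
  1ₚ +ₚ q ^ₚ s *ₚ [ a ℕ.+ b ]q^ s
    ≈⟨ +ₚ-congˡ 1ₚ (*ₚ-congˡ (q ^ₚ s) ([+]q^ a b s)) ⟩
  1ₚ +ₚ q ^ₚ s *ₚ ([ a ]q^ s +ₚ q ^ₚ (s ℕ.* a) *ₚ [ b ]q^ s)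
    ≈⟨ solve 4 (λ x y z w → con 1 :+ x :* (y :+ z :* w)
                         := (con 1 :+ x :* y) :+ x :* z :* w) P.refl
         (q ^ₚ s) ([ a ]q^ s) (q ^ₚ (s ℕ.* a)) ([ b ]q^ s) ⟩
  (1ₚ +ₚ q ^ₚ s *ₚ [ a ]q^ s) +ₚ q ^ₚ s *ₚ q ^ₚ (s ℕ.* a) *ₚ [ b ]q^ s
    ≈⟨ P.+-cong ([suc]q^ a s) (*ₚ-congʳ ([ b ]q^ s)
         (P.trans (^-congʳ q (ℕ.*-suc s a)) (^-homo-* q s (s ℕ.* a)))) ⟨
  [ suc a ]q^ s +ₚ q ^ₚ (s ℕ.* suc a) *ₚ [ b ]q^ s ∎
  where
  open SetoidReasoning P.setoid
  open PolySolver

[]q≈[]q^1 : ∀ m → [ m ]q ≈ₚ [ m ]q^ 1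
[]q≈[]q^1 m = sum-cong-≋ {m} (λ i → ^-congʳ q (sym (ℕ.*-identityˡ (toℕ i))))
  where open SemiringSum P.semiring using (sum-cong-≋)

[+]q : ∀ a b → [ a ℕ.+ b ]q ≈ₚ [ a ]q +ₚ q ^ₚ a *ₚ [ b ]q
[+]q a b = begin
  [ a ℕ.+ b ]q                            ≈⟨ []q≈[]q^1 (a ℕ.+ b) ⟩
  [ a ℕ.+ b ]q^ 1                         ≈⟨ [+]q^ a b 1 ⟩
  [ a ]q^ 1 +ₚ q ^ₚ (1 ℕ.* a) *ₚ [ b ]q^ 1
    ≈⟨ P.+-cong ([]q≈[]q^1 a)
         (P.*-cong (^-congʳ q (sym (ℕ.*-identityˡ a))) ([]q≈[]q^1 b)) ⟨
  [ a ]q +ₚ q ^ₚ a *ₚ [ b ]q              ∎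
  where open SetoidReasoning P.setoid

-- The exponents below `a * b` fall into `a` consecutive blocks of length `b`, and each block is
-- `[ b ]q` times a power of q^b. The roles of `a` and `b` are not symmetric: the second factor
-- becomes the plain q-number and the base of the other.
[*]q : ∀ a b → [ a ℕ.* b ]q ≈ₚ [ b ]q *ₚ [ a ]q^ b
[*]q zero    b = P.sym (P.zeroʳ [ b ]q)
[*]q (suc a) b = begin
  [ b ℕ.+ a ℕ.* b ]q                          ≈⟨ [+]q b (a ℕ.* b) ⟩
  [ b ]q +ₚ q ^ₚ b *ₚ [ a ℕ.* b ]q            ≈⟨ +ₚ-congˡ [ b ]q (*ₚ-congˡ (q ^ₚ b) ([*]q a b)) ⟩
  [ b ]q +ₚ q ^ₚ b *ₚ ([ b ]q *ₚ [ a ]q^ b)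
    ≈⟨ solve 3 (λ x y z → x :+ y :* (x :* z) := x :* (con 1 :+ y :* z)) P.refl
         [ b ]q (q ^ₚ b) ([ a ]q^ b) ⟩
  [ b ]q *ₚ (1ₚ +ₚ q ^ₚ b *ₚ [ a ]q^ b)       ≈⟨ *ₚ-congˡ [ b ]q ([suc]q^ a b) ⟨
  [ b ]q *ₚ [ suc a ]q^ b                     ∎
  where
  open SetoidReasoning P.setoid
  open PolySolver

-- Induction on `m` with `n` free: moving one unit from `m` to `n` keeps the index on the left, and
-- the Fibonacci recurrence regroups the right-hand side.
F-+ : ∀ m n → F (suc (m ℕ.+ n)) ≡ F (suc m) ℕ.* F (suc n) ℕ.+ F m ℕ.* F n
F-+ zero    n = sym (trans (ℕ.+-identityʳ _) (ℕ.+-identityʳ _))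
F-+ (suc m) n = begin
  F (suc (suc m ℕ.+ n))                                ≡⟨ cong (F ∘ suc) (ℕ.+-suc m n) ⟨
  F (suc (m ℕ.+ suc n))                                ≡⟨ F-+ m (suc n) ⟩
  F (suc m) ℕ.* F (suc (suc n)) ℕ.+ F m ℕ.* F (suc n)
    ≡⟨ regroup (F (suc m)) (F m) (F (suc n)) (F n) ⟩
  F (suc (suc m)) ℕ.* F (suc n) ℕ.+ F (suc m) ℕ.* F n  ∎
  where
  open ≡-Reasoning
  regroup : ∀ a b c d → a ℕ.* (c ℕ.+ d) ℕ.+ b ℕ.* c ≡ (a ℕ.+ b) ℕ.* c ℕ.+ a ℕ.* d
  regroup = ℕ-RingSolver.solve-∀

-- The order of the factors in `[*]q` is chosen so that `[ F (suc m) ]q` and `[ F k ]q` come out as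
-- plain q-numbers. These are the last factors of `[F (suc m) ]q!` and `[F k ]q!`, against which
-- they cancel in the recursion.
[F-+]q : ∀ k m → [ F (suc (k ℕ.+ m)) ]q ≈ₚ
  [ F (suc m) ]q *ₚ [ F (suc k) ]q^ F (suc m)
  +ₚ q ^ₚ (F (suc m) ℕ.* F (suc k)) *ₚ ([ F k ]q *ₚ [ F m ]q^ F k)
[F-+]q k m = begin
  [ F (suc (k ℕ.+ m)) ]q
    -- Only the second product is commuted, so that `[*]q` extracts `[ F k ]q` from it and not
    -- `[ F m ]q`.
    ≡⟨ cong [_]q (trans (F-+ k m)
         (cong (F (suc k) ℕ.* F (suc m) ℕ.+_) (ℕ.*-comm (F k) (F m)))) ⟩
  [ F (suc k) ℕ.* F (suc m) ℕ.+ F m ℕ.* F k ]q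
    ≈⟨ [+]q (F (suc k) ℕ.* F (suc m)) (F m ℕ.* F k) ⟩
  [ F (suc k) ℕ.* F (suc m) ]q +ₚ q ^ₚ (F (suc k) ℕ.* F (suc m)) *ₚ [ F m ℕ.* F k ]q
    ≈⟨ P.+-cong ([*]q (F (suc k)) (F (suc m)))
         (P.*-cong (^-congʳ q (ℕ.*-comm (F (suc k)) (F (suc m)))) ([*]q (F m) (F k))) ⟩
  [ F (suc m) ]q *ₚ [ F (suc k) ]q^ F (suc m)
    +ₚ q ^ₚ (F (suc m) ℕ.* F (suc k)) *ₚ ([ F k ]q *ₚ [ F m ]q^ F k) ∎
  where open SetoidReasoning P.setoid

-- The product unfolds at its first factor, whereas the recursion strips the last one.
[F-suc]q! : ∀ n → [F (suc n) ]q! ≈ₚ [F n ]q! *ₚ [ F (suc n) ]q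
[F-suc]q! n = begin
  productₚ {suc n} (λ t → [ F (suc (toℕ t)) ]q)
    ≈⟨ sum-init-last {n} (λ t → [ F (suc (toℕ t)) ]q) ⟩
  productₚ {n} (λ t → [ F (suc (toℕ (Fin.inject₁ t))) ]q)
    *ₚ [ F (suc (toℕ (Fin.fromℕ n))) ]q
    ≡⟨ cong₂ _*ₚ_ (sum-cong-≗ {n} (λ t → cong ([_]q ∘ F ∘ suc) (Fin.toℕ-inject₁ t)))
                  (cong ([_]q ∘ F ∘ suc) (Fin.toℕ-fromℕ n)) ⟩
  [F n ]q! *ₚ [ F (suc n) ]q ∎
  where
  open SetoidReasoning P.setoid
  open MonoidSum P.*-monoid using (sum-init-last; sum-cong-≗)

-- The recursion for q-Fibonomial coefficients

-- The factor relating the i-th summand for (n , k) to the (i + 1)-st summand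
-- for (n + 1 , k + 1).
shift : ℕ → ℕ → Poly
shift n k = q ^ₚ (F (n ∸ k) ℕ.* F (k ℕ.+ 2)) *ₚ [ F (n ∸ k ∸ 1) ]q^ F (k ℕ.+ 1)

module _ {c ℓ} (S : CommutativeSemiring c ℓ) where
  private module S = CommutativeSemiring S
  open S using (1#)

  -- This is `f′/(g′h′) = A f/(g′h) + Q B f/(g h′)` with denominators cleared. The letters `f`, `g`,
  -- `h` stand for q-factorials, the primed ones for their successors, and `x`, `y` for the new last
  -- factors of `g′`, `h′`. Eliminating the primed letters leaves an identity in eight variables.
  -- The factors `1#` are the denominators introduced by `ι`.
  cross-multiply : ∀ f g h x y A B Q {f′ g′ h′} →
    f′ S.≈ f S.* (y S.* A S.+ Q S.* (x S.* B)) → g′ S.≈ g S.* x → h′ S.≈ h S.* y →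
    f′ S.* ((1# S.* (g′ S.* h)) S.* (1# S.* (g S.* h′)))
    S.≈ (A S.* f S.* (1# S.* (g S.* h′)) S.+ Q S.* B S.* f S.* (1# S.* (g′ S.* h)))
        S.* (g′ S.* h′)
  cross-multiply f g h x y A B Q {f′} {g′} {h′} f′≈ g′≈ h′≈ = begin
    f′ S.* ((1# S.* (g′ S.* h)) S.* (1# S.* (g S.* h′)))
      ≈⟨ S.*-cong f′≈ (S.*-cong (S.*-congˡ (S.*-congʳ g′≈)) (S.*-congˡ (S.*-congˡ h′≈))) ⟩
    f S.* (y S.* A S.+ Q S.* (x S.* B))
      S.* ((1# S.* (g S.* x S.* h)) S.* (1# S.* (g S.* (h S.* y))))
      ≈⟨ solve 8 (λ f g h x y A B Q →
           f :* (y :* A :+ Q :* (x :* B))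
             :* (con 1 :* (g :* x :* h) :* (con 1 :* (g :* (h :* y))))
           := (A :* f :* (con 1 :* (g :* (h :* y)))
               :+ Q :* B :* f :* (con 1 :* (g :* x :* h)))
              :* (g :* x :* (h :* y)))
           S.refl f g h x y A B Q ⟩
    (A S.* f S.* (1# S.* (g S.* (h S.* y))) S.+ Q S.* B S.* f S.* (1# S.* (g S.* x S.* h)))
      S.* (g S.* x S.* (h S.* y))
      ≈⟨ S.*-cong (S.+-cong (S.*-congˡ (S.*-congˡ (S.*-congˡ h′≈)))
                            (S.*-congˡ (S.*-congˡ (S.*-congʳ g′≈))))
                  (S.*-cong g′≈ h′≈) ⟨
    (A S.* f S.* (1# S.* (g S.* h′)) S.+ Q S.* B S.* f S.* (1# S.* (g′ S.* h)))
      S.* (g′ S.* h′) ∎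
    where
    open SetoidReasoning S.setoid
    open SemiringSolver S

-- Cross-multiplied form of the recursion at n = k + 1 + m; the equations free
-- d = n ∸ k and e = n ∸ (k + 1) from the truncated subtractions.
cross-recursion : ∀ k m {n d e} → n ≡ suc k ℕ.+ m → d ≡ suc m → e ≡ m →
  let A = [ F (suc (suc k)) ]q^ F d
      C = q ^ₚ (F d ℕ.* F (suc (suc k))) *ₚ [ F (d ∸ 1) ]q^ F (suc k)
      D = 1ₚ *ₚ ([F (suc k) ]q! *ₚ [F e ]q!)
      E = 1ₚ *ₚ ([F k ]q! *ₚ [F d ]q!)
  in [F (suc n) ]q! *ₚ (D *ₚ E)
     ≈ₚ (A *ₚ [F n ]q! *ₚ E +ₚ C *ₚ [F n ]q! *ₚ D) *ₚ ([F (suc k) ]q! *ₚ [F d ]q!)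
cross-recursion k m refl refl refl =
  cross-multiply P.commutativeSemiring [F suc k ℕ.+ m ]q! [F k ]q! [F m ]q!
    [ F (suc k) ]q [ F (suc m) ]q ([ F (suc (suc k)) ]q^ F (suc m)) ([ F m ]q^ F (suc k))
    (q ^ₚ (F (suc m) ℕ.* F (suc (suc k))))
    (P.trans ([F-suc]q! (suc k ℕ.+ m)) (*ₚ-congˡ [F suc k ℕ.+ m ]q! ([F-+]q (suc k) m)))
    ([F-suc]q! k) ([F-suc]q! m)

qFibonomial-suc-suc : ∀ n k → k ℕ.< n →
  qFibonomial (suc n) (suc k)
  ≈ ι ([ F (suc k ℕ.+ 1) ]q^ F (n ∸ k)) * qFibonomial n (suc k)
    + ι (shift n k) * qFibonomial n k
-- The theorem writes `k + 1` and `k + 2`, while `cross-recursion` uses iterated `suc`.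
qFibonomial-suc-suc n k k<n rewrite ℕ.+-comm k 1 | ℕ.+-comm k 2 =
  -- Here m is `n ∸ suc k`. The second equation, `n ∸ k ≡ suc (n ∸ suc k)`, uses `k < n`: otherwise
  -- the truncated difference on the right would give 1.
  mk≈ (cross-recursion k (n ∸ suc k) (sym (ℕ.m+[n∸m]≡n k<n)) (ℕ.+-∸-assoc 1 k<n) refl)

qFibonomial-zero : ∀ n → qFibonomial n 0 ≈ ι 1ₚ
qFibonomial-zero n = mk≈ (solve 1 (λ f → f :* con 1 := con 1 :* (con 1 :* f)) P.refl [F n ]q!)
  where open PolySolver

-- Unfolding the recursion into the sum

summand : ℕ → ℕ → ℕ → RatFun
summand n k i =
  ι (q ^ₚ (F (n ∸ k) ℕ.* (∑ℕ[ j ∈ 1 ⋯ i ] F (k ∸ j ℕ.+ 2))))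
  * ι (∏ₚ[ j ∈ 1 ⋯ i ] ([ F (n ∸ k ∸ 1) ]q^ F (k ∸ j ℕ.+ 1)))
  * ι ([ F (k ∸ i ℕ.+ 1) ]q^ F (n ∸ k))
  * qFibonomial (n ∸ i ∸ 1) (k ∸ i)

-- At `i = 0` the inner sum and product are empty, so both prefactors are 1. What remains is, for
-- positive `k`, the first term of the Pascal-type rule.
summand-zero : ∀ n k →
  summand (suc n) k 0 ≈ ι ([ F (k ℕ.+ 1) ]q^ F (suc n ∸ k)) * qFibonomial n k
summand-zero n k = *-congʳ (qFibonomial n k) (begin
  ι (q ^ₚ (F (suc n ∸ k) ℕ.* 0)) * ι 1ₚ * a
    ≈⟨ *-congʳ a (*-congʳ (ι 1ₚ) (ι-cong (^-congʳ q (ℕ.*-zeroʳ (F (suc n ∸ k)))))) ⟩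
  ι 1ₚ * ι 1ₚ * a
    ≈⟨ *-congʳ a (R.*-identityˡ (ι 1ₚ)) ⟩
  ι 1ₚ * a
    ≈⟨ R.*-identityˡ a ⟩
  a ∎)
  where
  open SetoidReasoning R.setoid
  a = ι ([ F (k ℕ.+ 1) ]q^ F (suc n ∸ k))

-- Raising `n`, `k` and `i` together preserves `n ∸ k`, `k ∸ i` and `n ∸ i`. The inner sum and
-- product each gain a new term at `j = 1`, while their old terms move from `j` to `j + 1`; the two
-- new terms make up `shift n k`.
summand-suc : ∀ n k i →
  summand (suc n) (suc k) (suc i) ≈ ι (shift n k) * summand n k i
summand-suc n k i = begin
  ι (q ^ₚ (F d ℕ.* (F (k ℕ.+ 2) ℕ.+ S))) * ι (g *ₚ p) * a * b
    ≈⟨ *-congʳ b (*-congʳ a (R.*-cong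
         (R.trans (ι-cong (P.trans (^-congʳ q (ℕ.*-distribˡ-+ (F d) (F (k ℕ.+ 2)) S))
                                   (^-homo-* q (F d ℕ.* F (k ℕ.+ 2)) (F d ℕ.* S))))
                  (ι-*ₚ Q (q ^ₚ (F d ℕ.* S))))
         (ι-*ₚ g p))) ⟩
  ι Q * ι (q ^ₚ (F d ℕ.* S)) * (ι g * ι p) * a * b
    ≈⟨ regroup (ι Q) (ι (q ^ₚ (F d ℕ.* S))) (ι g) (ι p) a b ⟩
  ι Q * ι g * summand n k i
    ≈⟨ *-congʳ (summand n k i) (ι-*ₚ Q g) ⟨
  ι (shift n k) * summand n k i ∎
  where
  open SetoidReasoning R.setoid
  open RatFunSolver
  d = n ∸ k
  S = ∑ℕ[ j ∈ 1 ⋯ i ] F (k ∸ j ℕ.+ 2)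
  Q = q ^ₚ (F d ℕ.* F (k ℕ.+ 2))
  g = [ F (d ∸ 1) ]q^ F (k ℕ.+ 1)
  p = ∏ₚ[ j ∈ 1 ⋯ i ] ([ F (d ∸ 1) ]q^ F (k ∸ j ℕ.+ 1))
  a = ι ([ F (k ∸ i ℕ.+ 1) ]q^ F d)
  b = qFibonomial (n ∸ i ∸ 1) (k ∸ i)
  regroup : ∀ Q s g p a b → Q * s * (g * p) * a * b ≈ Q * g * (s * p * a * b)
  regroup = solve 6 (λ Q s g p a b → Q :* s :* (g :* p) :* a :* b
                                  := Q :* g :* (s :* p :* a :* b))
                    (λ {Q s g p a b} → R.refl)

-- Induction lowering `n` and `k` together: the first term of the Pascal-type rule is already the
-- summand at `i = 0`, and the induction hypothesis expands only the second.
qFibonomial-∑ : ∀ n k → k ≤ n → qFibonomial (suc n) k ≈ ∑ 0 k (summand (suc n) k)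
qFibonomial-∑ n zero    _ = R.sym (begin
  summand (suc n) 0 0 + ι 0ₚ                  ≈⟨ R.+-identityʳ _ ⟩
  summand (suc n) 0 0                         ≈⟨ summand-zero n 0 ⟩
  -- The index is `F (0 + 1)`, which computes to 1, so both sides reduce to 1.
  ι ([ 1 ]q^ F (suc n)) * qFibonomial n 0
    ≈⟨ R.*-cong (ι-cong ([1]q^ (F (suc n)))) (qFibonomial-zero n) ⟩
  ι 1ₚ * ι 1ₚ                                 ≈⟨ R.*-identityˡ (ι 1ₚ) ⟩
  ι 1ₚ                                        ≈⟨ qFibonomial-zero (suc n) ⟨
  qFibonomial (suc n) 0                       ∎)
  where
  open SetoidReasoning R.setoid
  [1]q^ : ∀ s → [ 1 ]q^ s ≈ₚ 1ₚ
  [1]q^ s = P.trans ([suc]q^ 0 s)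
           (P.trans (+ₚ-congˡ 1ₚ (P.zeroʳ (q ^ₚ s))) (P.+-identityʳ 1ₚ))
qFibonomial-∑ (suc n) (suc k) (s≤s k≤n) = begin
  qFibonomial (suc (suc n)) (suc k)
    ≈⟨ qFibonomial-suc-suc (suc n) k (s≤s k≤n) ⟩
  ι ([ F (suc k ℕ.+ 1) ]q^ F (suc n ∸ k)) * qFibonomial (suc n) (suc k)
    + ι (shift (suc n) k) * qFibonomial (suc n) k
    ≈⟨ R.+-cong (R.sym (summand-zero (suc n) (suc k)))
         (*-congˡ (ι (shift (suc n) k)) (qFibonomial-∑ n k k≤n)) ⟩
  summand (suc (suc n)) (suc k) 0
    + ι (shift (suc n) k) * ∑ 0 k (summand (suc n) k)
    ≈⟨ +-congˡ (summand (suc (suc n)) (suc k) 0)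
         (*-distribˡ-sum {suc k} (ι (shift (suc n) k))
           (λ t → summand (suc n) k (toℕ t))) ⟩
  summand (suc (suc n)) (suc k) 0
    + sum {suc k} (λ t → ι (shift (suc n) k) * summand (suc n) k (toℕ t))
    -- Multiplication by `shift` turns the summands `0 ⋯ k` into the summands `1 ⋯ suc k` of the
    -- larger sum, which by definition begins with the one at `i = 0`.
    ≈⟨ +-congˡ (summand (suc (suc n)) (suc k) 0)
         (sum-cong-≋ {suc k} (λ t → summand-suc (suc n) k (toℕ t))) ⟨
  ∑ 0 (suc k) (summand (suc (suc n)) (suc k)) ∎
  where
  open SetoidReasoning R.setoid
  open SemiringSum R.semiring using (sum; *-distribˡ-sum; sum-cong-≋)

proposition3p4 : (n k : ℕ) → 1 ≤ n → k ≤ n ∸ 1 →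
    qFibonomial n k ≈
    (∑[ i ∈ 0 ⋯ k ]
    (ι (q ^ₚ (F (n ∸ k) ℕ.* (∑ℕ[ j ∈ 1 ⋯ i ] F (k ∸ j ℕ.+ 2))))
    * ι (∏ₚ[ j ∈ 1 ⋯ i ] ([ F (n ∸ k ∸ 1) ]q^ F (k ∸ j ℕ.+ 1)))
    * ι ([ F (k ∸ i ℕ.+ 1) ]q^ F (n ∸ k))
    * qFibonomial (n ∸ i ∸ 1) (k ∸ i)))
-- For a successor, `n ∸ 1` computes, and the displayed sum is `summand` unfolded.
proposition3p4 (suc n) k _ k≤n = qFibonomial-∑ n k k≤n
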